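{- Let $\mathcal E$ be an equational program, let $t$ be a term and $I,J,K$ closed index terms such that $\vdash_I t:\mathsf{Nat}[J,K]$ (i.e. $\emptyset;\emptyset;\emptyset\vdash^{\mathcal E}_I t:\mathsf{Nat}[J,K]$ is derivable in $\mathsf{d}\ell\mathsf{PCF}$), and suppose $t\Downarrow^{n}\underline m$. Then $n\le |t|\cdot([\![I]\!]+1)$.
   Context: **Index terms.** A signature is a finite set of function symbols with arities, always containing $\mathbf 0,\mathbf 1$ (arity $0$) and $+,\dot-$ (arity $2$). Index terms: $I,J,K::=a\mid \mathtt f(I_1,\dots,I_k)\mid \sum_{a<I}J\mid\bigtriangleup_a^{I,J}K$, with $a$ an index variable (bound in $J$, resp. in $K$); $\mathbf n$ is $\mathbf 1+\dots+\mathbf 1$ ($n$ times); $X\{I/a\}$ is capture-avoiding substitution of $I$ for $a$. An equational program $\mathcal E$ is a set of equations between first-order terms over the signature, assumed to determine uniquely each function symbol as a partial function on $\mathbb N$ ($\mathbf 0,\mathbf 1,+$ standard, $\dot-$ truncated subtraction). For an assignment $\rho$ of naturals to index variables, $[\![I]\!]^{\mathcal E}_\rho$ (possibly undefined; $\rho$ and $\mathcal E$ omitted when clear) is the value of $I$: $\sum_{a<I}J$ is the sum of the values of $J$ for $a=0,\dots,I-1$; the forest cardinality satisfies $\bigtriangleup_a^{I,\mathbf 0}K=\mathbf 0$ and $\bigtriangleup_a^{I,J+\mathbf 1}K=F+\mathbf 1+\bigtriangleup_a^{I+\mathbf 1+F,\;K\{I+F/a\}}K$ with $F=\bigtriangleup_a^{I,J}K$,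 and is undefined when the unfolding does not terminate (it counts the nodes of a forest of $J$ trees numbered in pre-order starting from $I$, node $k$ having $K\{\mathbf k/a\}$ children). A constraint is $I\le J$ ($I<J$ means $I+\mathbf 1\le J$); it is true in $\rho$ if both sides are defined and the inequality holds. For a set $\phi$ of index variables and a set $\Phi$ of constraints over $\phi$, $\phi;\Phi\models I\le J$ means every assignment making all of $\Phi$ true makes $I\le J$ true; similarly for $=,\ge$. $\phi;\Phi\models I\Downarrow$ means $\phi;\Phi\models I\ge\mathbf 0$ (definedness). **Types.** Basic types $\sigma,\tau::=\mathsf{Nat}[I,J]\mid A\multimap\sigma$; modal types $A,B::=[a<I]\cdot\sigma$ ($a$ bound in $\sigma$); $\mathsf{Nat}[I]=\mathsf{Nat}[I,I]$. Subtyping $\phi;\Phi\vdash\cdot\sqsubseteq\cdot$: $\mathsf{Nat}[I,J]\sqsubseteq\mathsf{Nat}[K,H]$ if $\phi;\Phi\models K\le I$ and $\phi;\Phi\models J\le H$; $A\multimap\sigma\sqsubseteq B\multimap\tau$ if $B\sqsubseteq A$ and $\sigma\sqsubseteq\tau$; $[a<I]\cdot\sigma\sqsubseteq[a<J]\cdot\tau$ if $\phi,a;\Phi,a<I\vdash\sigma\sqsubseteq\tau$ and $\phi;\Phi\models J\le I$. A type is well defined, $\phi;\Phi\vdash\sigma\Downarrow$, if it is a subtype of itself. Sums: if $A=[a<I]\cdot\mu\{a/c\}$ and $B=[b<J]\cdot\mu\{I+b/c\}$ then $A\uplus B=[c<I+J]\cdot\mu$; if $A=[b<J]\cdot\sigma\{\sum_{d<a}J\{d/a\}+b/c\}$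 then $\sum_{a<I}A=[c<\sum_{a<I}J]\cdot\sigma$. Typing contexts assign modal types to distinct term variables; $\uplus,\sum,\sqsubseteq,\Downarrow$ extend to contexts pointwise. All index terms in types are assumed defined for the relevant values of variables. **Terms.** $t::=x\mid\underline n\mid\mathtt s(t)\mid\mathtt p(t)\mid\lambda x.t\mid tu\mid\mathtt{ifz}\ t\ \mathtt{then}\ u\ \mathtt{else}\ v\mid\mathtt{fix}\ x.t$. Size: $|x|=|\underline n|=1$, $|\mathtt s(t)|=|\mathtt p(t)|=|t|+2$, $|\lambda x.t|=|\mathtt{fix}\,x.t|=|t|+1$, $|tu|=|t|+|u|+1$, $|\mathtt{ifz}\ t\ \mathtt{then}\ u\ \mathtt{else}\ v|=|t|+|u|+|v|+1$. **Typing rules of $\mathsf{d}\ell\mathsf{PCF}$** (judgements $\phi;\Phi;\Gamma\vdash^{\mathcal E}_I t:\sigma$, weight $I$; below $\models,\vdash$ without left-hand side are under $\phi;\Phi$): (V) $\phi;\Phi;\Gamma,x:[a<I]\cdot\sigma\vdash_J x:\tau$ if $\models\mathbf 0\le J$, $\models\mathbf 1\le I$, $\vdash\sigma\{\mathbf 0/a\}\sqsubseteq\tau$, and $[a<I]\cdot\sigma$ and $\Gamma$ are well defined. (L) from $\phi;\Phi;\Gamma,x:[a<I]\cdot\sigma\vdash_J t:\tau$ infer $\phi;\Phi;\Gamma\vdash_J\lambda x.t:[a<I]\cdot\sigma\multimap\tau$. (A) from $\phi;\Phi;\Gamma\vdash_J t:[a<I]\cdot\sigma\multimap\tau$, $\phi,a;\Phi,a<I;\Delta\vdash_K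 u:\sigma$, $\vdash\Sigma\sqsubseteq\Gamma\uplus\sum_{a<I}\Delta$, $\models H\ge J+I+\sum_{a<I}K$ infer $\phi;\Phi;\Sigma\vdash_H tu:\tau$. (N) $\phi;\Phi;\Gamma\vdash_K\underline n:\mathsf{Nat}[I,J]$ if $\models K\ge\mathbf 0$, $\models I\le\mathbf n$, $\models\mathbf n\le J$, $\Gamma$ well defined. (S) from $\phi;\Phi;\Gamma\vdash_L t:\mathsf{Nat}[I,J]$ and $\vdash\mathsf{Nat}[I+\mathbf 1,J+\mathbf 1]\sqsubseteq\mathsf{Nat}[K,H]$ infer $\phi;\Phi;\Gamma\vdash_L\mathtt s(t):\mathsf{Nat}[K,H]$. (P) the same with $\mathtt p$ and $\dot-\mathbf 1$ instead of $\mathtt s$ and $+\mathbf 1$. (F) from $\phi;\Phi;\Gamma\vdash_K t:\mathsf{Nat}[I,J]$, $\phi;\Phi,I\le\mathbf 0;\Delta\vdash_H u:\sigma$, $\phi;\Phi,J\ge\mathbf 1;\Delta\vdash_H v:\sigma$, $\vdash\Sigma\sqsubseteq\Gamma\uplus\Delta$, $\models L\ge K+H$ infer $\phi;\Phi;\Sigma\vdash_L\mathtt{ifz}\ t\ \mathtt{then}\ u\ \mathtt{else}\ v:\sigma$. (R) from $\phi,b;\Phi,b<L;\Gamma,x:[a<I]\cdot\sigma\vdash_K t:\tau$, $\vdash\tau\{\mathbf 0/b\}\sqsubseteq\mu$, $\phi,a,b;\Phi,a<I,b<L\vdash\tau\{\bigtriangleup_b^{b+\mathbf 1,a}I+b+\mathbf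 1/b\}\sqsubseteq\sigma$, $\vdash\Sigma\sqsubseteq\sum_{b<L}\Gamma$, $\models\bigtriangleup_b^{\mathbf 0,\mathbf 1}I\le L$, $\models\bigtriangleup_b^{\mathbf 0,\mathbf 1}I\le M$, $\models N\ge(M\dot-\mathbf 1)+\sum_{b<L}K$ infer $\phi;\Phi;\Sigma\vdash_N\mathtt{fix}\ x.t:\mu$. **Machine.** Configurations are triples $(t,\rho,\xi)$: a term, an environment (finite sequence of closures), a stack (finite sequence of contexts). A closure is a pair (term, environment); a context is a closure, the symbol $\mathtt s$, the symbol $\mathtt p$, or a triple $(u,v,\rho)$ of two terms and an environment. Variable names are handled naively: each closure in an environment is attached to the variable for which it was pushed, and $(t_x,\rho_x)$ is the closure attached to $x$. Transitions: $(tu,\rho,\xi)\to(t,\rho,(u,\rho)\cdot\xi)$; $(\lambda x.t,\rho,c\cdot\xi)\to(t,c\cdot\rho,\xi)$; $(x,\rho,\xi)\to(t_x,\rho_x,\xi)$; $(\mathtt{ifz}\ t\ \mathtt{then}\ u\ \mathtt{else}\ v,\rho,\xi)\to(t,\rho,(u,v,\rho)\cdot\xi)$; $(\mathtt{fix}\,x.t,\rho,\xi)\to(t,(\mathtt{fix}\,x.t,\rho)\cdot\rho,\xi)$; $(\underline n,\rho,\mathtt s\cdot\xi)\to(\underline{n+1},\rho,\xi)$; $(\underline n,\rho,\mathtt p\cdot\xi)\to(\underline{n\dot-1},\rho,\xi)$; $(\underline 0,\rho,(t,u,\mu)\cdot\xi)\to(t,\mu,\xi)$; $(\underline{n+1},\rho,(t,u,\mu)\cdot\xi)\to(u,\mu,\xi)$;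 $(\mathtt s(t),\rho,\xi)\to(t,\rho,\mathtt s\cdot\xi)$; $(\mathtt p(t),\rho,\xi)\to(t,\rho,\mathtt p\cdot\xi)$. With $\varepsilon$ the empty sequence, $t\Downarrow^n\underline m$ means $(t,\varepsilon,\varepsilon)$ reaches $(\underline m,\rho,\varepsilon)$, for some $\rho$, in exactly $n$ transitions. -}

module Defs where

open import Data.Fin using (Fin; zero; suc; lift)
open import Data.List using (List; []; _∷_; map)
open import Data.List.Relation.Unary.All using (All)
open import Data.Nat using (ℕ; zero; suc; _+_; _∸_; _≤_)
open import Data.Product using (_×_; ∃-syntax; Σ-syntax)
open import Data.Vec using (Vec; []; _∷_; lookup)
open import Data.Vec.Relation.Binary.Pointwise.Inductive using (Pointwise)
open import Function using (_∘_; _⇔_)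
open import Level using (0ℓ)
open import Relation.Binary.PropositionalEquality using (_≡_)
open import Relation.Unary using (Pred)

-- The four compulsory symbols are the constructors of Symbol below, so a
-- signature only has to list the other ones.
record Signature : Set where
  field
    #user      : ℕ
    user-arity : Fin #user → ℕ

open Signature

data Symbol (S : Signature) : Set where
  `0 `1 `+ `∸ : Symbol S
  user        : Fin (#user S) → Symbol S

arity : ∀ {S} → Symbol S → ℕ
arity     `0       = 0
arity     `1       = 0
arity     `+       = 2
arity     `∸       = 2
arity {S} (user f) = user-arity S f

-- Partial functions on ℕ are given by their graphs, i.e. single-valued relations.
record Interpretation (S : Signature) : Set₁ where
  field
    user-graph    : (f : Fin (#user S)) → Vec ℕ (user-arity S f) → ℕ → Set
    single-valued : ∀ f {xs m m'} → user-graph f xs m → user-graph f xs m' → m ≡ m'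

  graph : (f : Symbol S) → Vec ℕ (arity f) → ℕ → Set
  graph `0       []           m = m ≡ 0
  graph `1       []           m = m ≡ 1
  graph `+       (x ∷ y ∷ []) m = m ≡ x + y
  graph `∸       (x ∷ y ∷ []) m = m ≡ x ∸ y
  graph (user f) xs           m = user-graph f xs m

open Interpretation using (user-graph; graph)

data FOTerm (S : Signature) (n : ℕ) : Set where
  var : Fin n → FOTerm S n
  fn  : (f : Symbol S) → Vec (FOTerm S n) (arity f) → FOTerm S n

data Value {S} (M : Interpretation S) {n} (ρ : Vec ℕ n) : FOTerm S n → ℕ → Set where
  var : ∀ x → Value M ρ (var x) (lookup ρ x)
  fn  : ∀ {f ts vs m} → Pointwise (Value M ρ) ts vs → graph M f vs m →
        Value M ρ (fn f ts) m

record Equation (S : Signature) : Set where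
  constructor _≐_
  field
    {#vars} : ℕ
    lhs rhs : FOTerm S #vars

-- Kleene equality: the two sides are undefined together, and equal when defined.
Satisfies : ∀ {S} → Interpretation S → Equation S → Set
Satisfies M (s ≐ t) = ∀ ρ m → Value M ρ s m ⇔ Value M ρ t m

-- The partial functions determined by the equations are the least ones that
-- satisfy them, as usual for recursive definitions.  They are unique, and they
-- are the only solution whenever there is only one.
record EquationalProgram (S : Signature) : Set₁ where
  field
    equations : Pred (Equation S) 0ℓ
    meaning   : Interpretation S
    satisfied : ∀ e → equations e → Satisfies meaning e
    least     : ∀ M → (∀ e → equations e → Satisfies M e) →
                ∀ f xs m → user-graph meaning f xs m → user-graph M f xs m

-- The n index variables are de Bruijn indices.
data Index (S : Signature) (n : ℕ) : Set where
  var : Fin n → Index S n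
  fn  : (f : Symbol S) → Vec (Index S n) (arity f) → Index S n
  -- ∑ I J is ∑_{a<I} J, with a the variable 0 of J
  ∑   : Index S n → Index S (suc n) → Index S n
  -- △ I J K is the forest cardinality △_a^{I,J} K, with a the variable 0 of K
  △   : Index S n → Index S n → Index S (suc n) → Index S n

infixl 6 _⊕_ _⊖_

pattern 𝟎       = fn `0 []
pattern 𝟏       = fn `1 []
pattern _⊕_ I J = fn `+ (I ∷ J ∷ [])
pattern _⊖_ I J = fn `∸ (I ∷ J ∷ [])

numeral : ∀ {S n} → ℕ → Index S n
numeral zero          = 𝟎
numeral (suc zero)    = 𝟏
numeral (suc (suc k)) = numeral (suc k) ⊕ 𝟏

mutual
  ren : ∀ {S n k} → (Fin n → Fin k) → Index S n → Index S k
  ren r (var x)   = var (r x)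
  ren r (fn f Is) = fn f (ren* r Is)
  ren r (∑ I J)   = ∑ (ren r I) (ren (lift 1 r) J)
  ren r (△ I J K) = △ (ren r I) (ren r J) (ren (lift 1 r) K)

  ren* : ∀ {S n k l} → (Fin n → Fin k) → Vec (Index S n) l → Vec (Index S k) l
  ren* r []       = []
  ren* r (I ∷ Is) = ren r I ∷ ren* r Is

wk : ∀ {S n} → Index S n → Index S (suc n)
wk = ren suc

Sub : Signature → ℕ → ℕ → Set
Sub S n k = Fin n → Index S k

↑ : ∀ {S n} → Sub S n (suc n)
↑ x = var (suc x)

↑² : ∀ {S n} → Sub S n (suc (suc n))
↑² x = var (suc (suc x))

-- Variable 0 goes to I, the others are substituted by θ.
infixr 5 _▹_
_▹_ : ∀ {S n k} → Index S k → Sub S n k → Sub S (suc n) k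
(I ▹ θ) zero    = I
(I ▹ θ) (suc x) = θ x

lift-sub : ∀ {S n k} → Sub S n k → Sub S (suc n) (suc k)
lift-sub θ = var zero ▹ (wk ∘ θ)

mutual
  sub : ∀ {S n k} → Sub S n k → Index S n → Index S k
  sub θ (var x)   = θ x
  sub θ (fn f Is) = fn f (sub* θ Is)
  sub θ (∑ I J)   = ∑ (sub θ I) (sub (lift-sub θ) J)
  sub θ (△ I J K) = △ (sub θ I) (sub θ J) (sub (lift-sub θ) K)

  sub* : ∀ {S n k l} → Sub S n k → Vec (Index S n) l → Vec (Index S k) l
  sub* θ []       = []
  sub* θ (I ∷ Is) = sub θ I ∷ sub* θ Is

-- I < J is the constraint (I ⊕ 𝟏) ≤ᶜ J, and I ≥ J is J ≤ᶜ I.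
infix 4 _≤ᶜ_ _<ᶜ_ _≥ᶜ_
data Constraint (S : Signature) (n : ℕ) : Set where
  _≤ᶜ_ : Index S n → Index S n → Constraint S n

_<ᶜ_ _≥ᶜ_ : ∀ {S n} → Index S n → Index S n → Constraint S n
I <ᶜ J = I ⊕ 𝟏 ≤ᶜ J
I ≥ᶜ J = J ≤ᶜ I

wkᶜ : ∀ {S n} → Constraint S n → Constraint S (suc n)
wkᶜ (I ≤ᶜ J) = wk I ≤ᶜ wk J

-- A set of constraints is a list of constraints.
Constraints : Signature → ℕ → Set
Constraints S n = List (Constraint S n)

wkᶜˢ : ∀ {S n} → Constraints S n → Constraints S (suc n)
wkᶜˢ = map wkᶜ

infixr 5 _⊸_
infix  6 [<_]·_
mutual
  data Basic (S : Signature) (n : ℕ) : Set where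
    Nat[_,_] : Index S n → Index S n → Basic S n
    _⊸_      : Modal S n → Basic S n → Basic S n

  -- [< I ]· σ is [a<I]·σ, with a the variable 0 of σ
  data Modal (S : Signature) (n : ℕ) : Set where
    [<_]·_ : Index S n → Basic S (suc n) → Modal S n

mutual
  subᵇ : ∀ {S n k} → Sub S n k → Basic S n → Basic S k
  subᵇ θ Nat[ I , J ] = Nat[ sub θ I , sub θ J ]
  subᵇ θ (A ⊸ σ)      = subᵐ θ A ⊸ subᵇ θ σ

  subᵐ : ∀ {S n k} → Sub S n k → Modal S n → Modal S k
  subᵐ θ ([< I ]· σ) = [< sub θ I ]· subᵇ (lift-sub θ) σ

data _⊎_≈_ {S n} : Modal S n → Modal S n → Modal S n → Set where
  -- μ has c as variable 0; in the second summand b takes its place.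
  union : ∀ {I J} {μ : Basic S (suc n)} →
    ([< I ]· μ) ⊎ ([< J ]· subᵇ ((wk I ⊕ var zero) ▹ ↑) μ)
      ≈ ([< I ⊕ J ]· μ)

-- Sum I A B means that B is ∑_{a<I} A.
data Sum {S n} (I : Index S n) : Modal S (suc n) → Modal S n → Set where
  -- In the type of A, b is variable 0 and a is variable 1; J{d/a} lives under
  -- a, b and d.
  sum : ∀ {J : Index S (suc n)} {σ : Basic S (suc n)} →
    Sum I
      ([< J ]· subᵇ ((∑ (var (suc zero)) (ren (lift 1 (λ x → suc (suc x))) J) ⊕ var zero)
                      ▹ ↑²) σ)
      ([< ∑ I J ]· σ)

-- A context gives a type to each of the k term variables in scope.
Context : Signature → ℕ → ℕ → Set
Context S n k = Vec (Modal S n) k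

_⊎ᶜ_≈_ : ∀ {S n k} → Context S n k → Context S n k → Context S n k → Set
Γ ⊎ᶜ Δ ≈ Θ = ∀ x → lookup Γ x ⊎ lookup Δ x ≈ lookup Θ x

Sumᶜ : ∀ {S n k} → Index S n → Context S (suc n) k → Context S n k → Set
Sumᶜ I Γ Δ = ∀ x → Sum I (lookup Γ x) (lookup Δ x)

infixl 7 _·_
-- The k term variables in scope are de Bruijn indices.
data Term (k : ℕ) : Set where
  var           : Fin k → Term k
  num           : ℕ → Term k
  s p           : Term k → Term k
  ƛ             : Term (suc k) → Term k
  _·_           : Term k → Term k → Term k
  ifz_then_else_ : Term k → Term k → Term k → Term k
  fix           : Term (suc k) → Term k

∣_∣ : ∀ {k} → Term k → ℕ
∣ var x ∣                = 1
∣ num n ∣                = 1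
∣ s t ∣                  = ∣ t ∣ + 2
∣ p t ∣                  = ∣ t ∣ + 2
∣ ƛ t ∣                  = ∣ t ∣ + 1
∣ t · u ∣                = ∣ t ∣ + ∣ u ∣ + 1
∣ ifz t then u else v ∣  = ∣ t ∣ + ∣ u ∣ + ∣ v ∣ + 1
∣ fix t ∣                = ∣ t ∣ + 1

module dℓPCF {S : Signature} (E : EquationalProgram S) where

  open EquationalProgram E using (meaning)

  -- ρ ⊢ I ⇓ m: the value of I under the assignment ρ is defined and equal to m.
  -- Every construct is strict in its index terms, △ also in its starting point.
  infix 4 _⊢_⇓_
  mutual
    data _⊢_⇓_ {n} (ρ : Vec ℕ n) : Index S n → ℕ → Set where
      var : ∀ a → ρ ⊢ var a ⇓ lookup ρ a
      fn  : ∀ {f Is vs m} → Pointwise (ρ ⊢_⇓_) Is vs → graph meaning f vs m →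
            ρ ⊢ fn f Is ⇓ m
      ∑   : ∀ {I J i m} → ρ ⊢ I ⇓ i → SumBelow ρ J i m → ρ ⊢ ∑ I J ⇓ m
      △   : ∀ {I J K i j m} → ρ ⊢ I ⇓ i → ρ ⊢ J ⇓ j → Forest ρ K i j m →
            ρ ⊢ △ I J K ⇓ m

    -- SumBelow ρ J i m: the values of J for a = 0, …, i ∸ 1 add up to m.
    data SumBelow {n} (ρ : Vec ℕ n) (J : Index S (suc n)) : ℕ → ℕ → Set where
      zero : SumBelow ρ J 0 0
      suc  : ∀ {i m v} → SumBelow ρ J i m → i ∷ ρ ⊢ J ⇓ v → SumBelow ρ J (suc i) (m + v)

    -- Forest ρ K i j m: the forest cardinality starting from i, with j trees, is m.
    -- In suc, f nodes precede the root of the last tree, which is node i + f and has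
    -- k children.
    data Forest {n} (ρ : Vec ℕ n) (K : Index S (suc n)) : ℕ → ℕ → ℕ → Set where
      zero : ∀ {i} → Forest ρ K i 0 0
      suc  : ∀ {i j f k g} → Forest ρ K i j f → i + f ∷ ρ ⊢ K ⇓ k →
             Forest ρ K (i + 1 + f) k g → Forest ρ K i (suc j) (f + 1 + g)

  True : ∀ {n} → Vec ℕ n → Constraint S n → Set
  True ρ (I ≤ᶜ J) = ∃[ i ] ∃[ j ] (ρ ⊢ I ⇓ i) × (ρ ⊢ J ⇓ j) × i ≤ j

  infix 3 _⊨_
  _⊨_ : ∀ {n} → Constraints S n → Constraint S n → Set
  Φ ⊨ C = ∀ ρ → All (True ρ) Φ → True ρ C

  infix 3 _⊢_⊑ᵇ_ _⊢_⊑ᵐ_ _⊢_⊑ᶜ_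
  mutual
    data _⊢_⊑ᵇ_ {n} (Φ : Constraints S n) : Basic S n → Basic S n → Set where
      nat : ∀ {I J K H} → Φ ⊨ K ≤ᶜ I → Φ ⊨ J ≤ᶜ H → Φ ⊢ Nat[ I , J ] ⊑ᵇ Nat[ K , H ]
      arr : ∀ {A B σ τ} → Φ ⊢ B ⊑ᵐ A → Φ ⊢ σ ⊑ᵇ τ → Φ ⊢ A ⊸ σ ⊑ᵇ B ⊸ τ

    data _⊢_⊑ᵐ_ {n} (Φ : Constraints S n) : Modal S n → Modal S n → Set where
      mod : ∀ {I J σ τ} → (var zero <ᶜ wk I) ∷ wkᶜˢ Φ ⊢ σ ⊑ᵇ τ → Φ ⊨ J ≤ᶜ I →
            Φ ⊢ [< I ]· σ ⊑ᵐ [< J ]· τ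

  _⊢_⊑ᶜ_ : ∀ {n k} → Constraints S n → Context S n k → Context S n k → Set
  Φ ⊢ Γ ⊑ᶜ Δ = ∀ x → Φ ⊢ lookup Γ x ⊑ᵐ lookup Δ x

  infix 3 _⊢_⇓ᶜ
  _⊢_⇓ᶜ : ∀ {n k} → Constraints S n → Context S n k → Set
  Φ ⊢ Γ ⇓ᶜ = Φ ⊢ Γ ⊑ᶜ Γ

  -- Φ ⨾ Γ ⊢[ I ] t ∶ σ is the judgement φ;Φ;Γ ⊢_I t : σ, where φ consists of n
  -- index variables.
  infix 2 _⨾_⊢[_]_∶_
  data _⨾_⊢[_]_∶_ {n k} (Φ : Constraints S n) :
         Context S n k → Index S n → Term k → Basic S n → Set where

    -- The context here includes the declaration of x, so that its being well
    -- defined covers the type of x.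
    T-V : ∀ {Γ x I σ J τ} →
      lookup Γ x ≡ [< I ]· σ →
      Φ ⊨ 𝟎 ≤ᶜ J →
      Φ ⊨ 𝟏 ≤ᶜ I →
      Φ ⊢ subᵇ (𝟎 ▹ var) σ ⊑ᵇ τ →
      Φ ⊢ Γ ⇓ᶜ →
      Φ ⨾ Γ ⊢[ J ] var x ∶ τ

    T-L : ∀ {Γ I σ J t τ} →
      Φ ⨾ ([< I ]· σ) ∷ Γ ⊢[ J ] t ∶ τ →
      Φ ⨾ Γ ⊢[ J ] ƛ t ∶ [< I ]· σ ⊸ τ

    T-A : ∀ {Γ Δ Δ' Θ Ψ I J K H t u σ τ} →
      Φ ⨾ Γ ⊢[ J ] t ∶ [< I ]· σ ⊸ τ →
      (var zero <ᶜ wk I) ∷ wkᶜˢ Φ ⨾ Δ ⊢[ K ] u ∶ σ →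
      Sumᶜ I Δ Δ' → Γ ⊎ᶜ Δ' ≈ Θ → Φ ⊢ Ψ ⊑ᶜ Θ →
      Φ ⊨ H ≥ᶜ J ⊕ I ⊕ ∑ I K →
      Φ ⨾ Ψ ⊢[ H ] t · u ∶ τ

    T-N : ∀ {Γ I J K m} →
      Φ ⊨ K ≥ᶜ 𝟎 →
      Φ ⊨ I ≤ᶜ numeral m →
      Φ ⊨ numeral m ≤ᶜ J →
      Φ ⊢ Γ ⇓ᶜ →
      Φ ⨾ Γ ⊢[ K ] num m ∶ Nat[ I , J ]

    T-S : ∀ {Γ I J K H M t} →
      Φ ⨾ Γ ⊢[ M ] t ∶ Nat[ I , J ] →
      Φ ⊢ Nat[ I ⊕ 𝟏 , J ⊕ 𝟏 ] ⊑ᵇ Nat[ K , H ] →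
      Φ ⨾ Γ ⊢[ M ] s t ∶ Nat[ K , H ]

    T-P : ∀ {Γ I J K H M t} →
      Φ ⨾ Γ ⊢[ M ] t ∶ Nat[ I , J ] →
      Φ ⊢ Nat[ I ⊖ 𝟏 , J ⊖ 𝟏 ] ⊑ᵇ Nat[ K , H ] →
      Φ ⨾ Γ ⊢[ M ] p t ∶ Nat[ K , H ]

    T-F : ∀ {Γ Δ Θ Ψ I J K H M t u v σ} →
      Φ ⨾ Γ ⊢[ K ] t ∶ Nat[ I , J ] →
      (I ≤ᶜ 𝟎) ∷ Φ ⨾ Δ ⊢[ H ] u ∶ σ →
      (J ≥ᶜ 𝟏) ∷ Φ ⨾ Δ ⊢[ H ] v ∶ σ →
      Γ ⊎ᶜ Δ ≈ Θ → Φ ⊢ Ψ ⊑ᶜ Θ →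
      Φ ⊨ M ≥ᶜ K ⊕ H →
      Φ ⨾ Ψ ⊢[ M ] ifz t then u else v ∶ σ

    -- Γ, I, K and τ live under b, and σ under b (variable 1) and a (variable 0).
    T-R : ∀ {Γ Θ Ψ I K L M N t σ τ μ} →
      (var zero <ᶜ wk L) ∷ wkᶜˢ Φ ⨾ ([< I ]· σ) ∷ Γ ⊢[ K ] t ∶ τ →
      Φ ⊢ subᵇ (𝟎 ▹ var) τ ⊑ᵇ μ →
      (var zero <ᶜ wk I) ∷ (var (suc zero) <ᶜ wk (wk L)) ∷ wkᶜˢ (wkᶜˢ Φ) ⊢
        subᵇ ((△ (var (suc zero) ⊕ 𝟏) (var zero) (ren (lift 1 (λ x → suc (suc x))) I)
                ⊕ var (suc zero) ⊕ 𝟏)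
              ▹ ↑²) τ
        ⊑ᵇ σ →
      Sumᶜ L Γ Θ → Φ ⊢ Ψ ⊑ᶜ Θ →
      Φ ⊨ △ 𝟎 𝟏 I ≤ᶜ L →
      Φ ⊨ △ 𝟎 𝟏 I ≤ᶜ M →
      Φ ⊨ N ≥ᶜ (M ⊖ 𝟏) ⊕ ∑ L K →
      Φ ⨾ Ψ ⊢[ N ] fix t ∶ μ

-- An environment for a term with k free variables; its x-th closure is the one
-- attached to the variable x.
data Closure : Set where
  ⟨_,_⟩ : ∀ {k} → Term k → Vec Closure k → Closure

Env : ℕ → Set
Env = Vec Closure

data Frame : Set where
  arg    : Closure → Frame
  s p    : Frame
  branch : ∀ {k} → Term k → Term k → Env k → Frame

Stack : Set
Stack = List Frame

data Config : Set where
  ⟪_,_,_⟫ : ∀ {k} → Term k → Env k → Stack → Config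

enter : Closure → Stack → Config
enter ⟨ t , ρ ⟩ ξ = ⟪ t , ρ , ξ ⟫

infix 4 _⟶_ _⟶[_]_
data _⟶_ : Config → Config → Set where
  app   : ∀ {k} {t u : Term k} {ρ ξ} →
          ⟪ t · u , ρ , ξ ⟫ ⟶ ⟪ t , ρ , arg ⟨ u , ρ ⟩ ∷ ξ ⟫
  lam   : ∀ {k} {t : Term (suc k)} {ρ c ξ} →
          ⟪ ƛ t , ρ , arg c ∷ ξ ⟫ ⟶ ⟪ t , c ∷ ρ , ξ ⟫
  var   : ∀ {k} {x : Fin k} {ρ ξ} →
          ⟪ var x , ρ , ξ ⟫ ⟶ enter (lookup ρ x) ξ
  ifz   : ∀ {k} {t u v : Term k} {ρ ξ} →
          ⟪ ifz t then u else v , ρ , ξ ⟫ ⟶ ⟪ t , ρ , branch u v ρ ∷ ξ ⟫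
  fix   : ∀ {k} {t : Term (suc k)} {ρ ξ} →
          ⟪ fix t , ρ , ξ ⟫ ⟶ ⟪ t , ⟨ fix t , ρ ⟩ ∷ ρ , ξ ⟫
  num-s : ∀ {k n} {ρ : Env k} {ξ} →
          ⟪ num n , ρ , s ∷ ξ ⟫ ⟶ ⟪ num (suc n) , ρ , ξ ⟫
  num-p : ∀ {k n} {ρ : Env k} {ξ} →
          ⟪ num n , ρ , p ∷ ξ ⟫ ⟶ ⟪ num (n ∸ 1) , ρ , ξ ⟫
  num-0 : ∀ {k l} {ρ : Env k} {t u : Term l} {μ ξ} →
          ⟪ num 0 , ρ , branch t u μ ∷ ξ ⟫ ⟶ ⟪ t , μ , ξ ⟫
  num-+ : ∀ {k l n} {ρ : Env k} {t u : Term l} {μ ξ} →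
          ⟪ num (suc n) , ρ , branch t u μ ∷ ξ ⟫ ⟶ ⟪ u , μ , ξ ⟫
  s     : ∀ {k} {t : Term k} {ρ ξ} →
          ⟪ s t , ρ , ξ ⟫ ⟶ ⟪ t , ρ , s ∷ ξ ⟫
  p     : ∀ {k} {t : Term k} {ρ ξ} →
          ⟪ p t , ρ , ξ ⟫ ⟶ ⟪ t , ρ , p ∷ ξ ⟫

data _⟶[_]_ : Config → ℕ → Config → Set where
  done : ∀ {C} → C ⟶[ 0 ] C
  step : ∀ {C D D' n} → C ⟶ D → D ⟶[ n ] D' → C ⟶[ suc n ] D'

infix 4 _⇓[_]_
_⇓[_]_ : Term 0 → ℕ → ℕ → Set
t ⇓[ n ] m = ∃[ k ] Σ[ ρ ∈ Env k ] ⟪ t , [] , [] ⟫ ⟶[ n ] ⟪ num m , ρ , [] ⟫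

{-# OPTIONS --safe #-}

-- Types are interpreted as sets of stacks with a budget of machine steps: a
-- closure realises σ at cost w when all its runs have at most w + v steps against
-- every stack accepting σ with budget v, and it supplies [a<I]·σ when it realises
-- each of the I instances of σ, the costs being added up.  No type need be
-- defined for this to make sense, so dead branches of a conditional are harmless.
-- Write B for the size of the whole program.  A term t of weight i realises its
-- type at cost ∣t∣ + B·i plus the cost of its environment: a step inside t is paid
-- by ∣t∣, and a variable lookup, which starts a fresh closure of size at most B, by
-- the unit of weight that the typing rules charge for every copy of an argument.
-- A fixpoint is unrolled along the forest counted by △, one node for each copy.
module Submission where

open import Data.Fin using (Fin; zero; suc; lift)
open import Data.List using ([]; _∷_)
open import Data.List.Relation.Unary.All using (All; []; _∷_)
open import Data.Nat using (ℕ; zero; suc; _+_; _*_; _∸_; _≤_; _<_; z≤n; s≤s)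
open import Data.Nat.Properties
open import Data.Nat.Tactic.RingSolver using (solve-∀)
open import Data.Product using (_×_; _,_; ∃-syntax)
open import Data.Vec using (Vec; []; _∷_; lookup)
open import Data.Vec.Relation.Binary.Pointwise.Inductive using (Pointwise; []; _∷_)
open import Function using (_∘_; _⇔_; mk⇔; Equivalence)
open import Relation.Binary.PropositionalEquality
  using (_≡_; refl; sym; trans; cong; cong₂; subst)
open import Defs

open Equivalence using (to; from)

-- Bounds on the length of runs

Safe : Config → ℕ → Set
Safe C b = ∀ {n D} → C ⟶[ n ] D → n ≤ b

Safe-mono : ∀ {C b b'} → b ≤ b' → Safe C b → Safe C b'
Safe-mono b≤b' safe run = ≤-trans (safe run) b≤b'

-- Unfinished runs count as well, so one step more than a bound common to all successors is enough,
-- and a stuck configuration passes vacuously.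
Safe-step : ∀ {C b} → (∀ {D} → C ⟶ D → Safe D b) → Safe C (suc b)
Safe-step next done         = z≤n
Safe-step next (step r run) = s≤s (next r run)

-- This serves the conditional: the size of the branch not taken pays for the step that selects the
-- other one.
1≤∣_∣ : ∀ {k} (t : Term k) → 1 ≤ ∣ t ∣
1≤∣ var x ∣               = ≤-refl
1≤∣ num n ∣               = ≤-refl
1≤∣ s t ∣                 = m≤n⇒m≤n+o 2 1≤∣ t ∣
1≤∣ p t ∣                 = m≤n⇒m≤n+o 2 1≤∣ t ∣
1≤∣ ƛ t ∣                 = m≤n+m 1 ∣ t ∣
1≤∣ t · u ∣               = m≤n+m 1 (∣ t ∣ + ∣ u ∣)
1≤∣ ifz t then u else v ∣ = m≤n+m 1 (∣ t ∣ + ∣ u ∣ + ∣ v ∣)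
1≤∣ fix t ∣               = m≤n+m 1 ∣ t ∣

-- Sharing a cost among numbered copies

infixl 5 _∷ʳ_⟨_⟩
-- Growing at the end keeps the numbering from 0 and matches `SumBelow`. The total is only an upper
-- bound, so that budgets can be weakened and copies dropped.
data Copies (R : ℕ → ℕ → Set) : ℕ → ℕ → Set where
  []      : ∀ {w} → Copies R 0 w
  _∷ʳ_⟨_⟩ : ∀ {n u v w} → Copies R n u → R n v → u + v ≤ w → Copies R (suc n) w

module _ {R : ℕ → ℕ → Set} where

  Copies-mono : ∀ {n w w'} → w ≤ w' → Copies R n w → Copies R n w'
  Copies-mono w≤w' []                = []
  Copies-mono w≤w' (cs ∷ʳ r ⟨ le ⟩) = cs ∷ʳ r ⟨ ≤-trans le w≤w' ⟩

  Copies-map : ∀ {R' : ℕ → ℕ → Set} {n w} → (∀ {a u} → a < n → R a u → R' a u) →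
               Copies R n w → Copies R' n w
  Copies-map f []                = []
  Copies-map f (cs ∷ʳ r ⟨ le ⟩) = Copies-map (f ∘ m<n⇒m<1+n) cs ∷ʳ f ≤-refl r ⟨ le ⟩

  Copies-split : ∀ {w} i j → Copies R (i + j) w →
    ∃[ u ] ∃[ v ] Copies R i u × Copies (R ∘ (i +_)) j v × u + v ≤ w
  Copies-split {w} i zero cs rewrite +-identityʳ i = w , 0 , cs , [] , ≤-reflexive (+-identityʳ w)
  Copies-split {w} i (suc j) cs rewrite +-suc i j with cs
  ... | cs' ∷ʳ r ⟨ le ⟩ with Copies-split i j cs'
  ... | u , v , cs₁ , cs₂ , le' =
    u , v + _ , cs₁ , cs₂ ∷ʳ r ⟨ ≤-refl ⟩ ,
    ≤-trans (≤-reflexive (sym (+-assoc u v _))) (≤-trans (+-monoˡ-≤ _ le') le)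

  Copies-take : ∀ {i j w} → j ≤ i → Copies R i w → Copies R j w
  Copies-take {i} {j} j≤i cs
    with Copies-split j (i ∸ j) (subst (λ n → Copies R n _) (sym (m+[n∸m]≡n j≤i)) cs)
  ... | u , v , cs₁ , _ , le = Copies-mono (≤-trans (m≤m+n u v) le) cs₁

  Copies-single : ∀ {w} → Copies R 1 w → ∃[ u ] R 0 u × u ≤ w
  Copies-single ([] ∷ʳ r ⟨ le ⟩) = _ , r , m+n≤o⇒n≤o _ le

interchange : ∀ a b c d → (a + b) + (c + d) ≡ (a + c) + (b + d)
interchange = solve-∀

Copies-zip : ∀ {P Q R : ℕ → ℕ → Set} {n x y} →
  (∀ {a u v} → P a u → Q a v → R a (u + v)) →
  Copies P n x → Copies Q n y → Copies R n (x + y)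
Copies-zip f [] [] = []
Copies-zip f (_∷ʳ_⟨_⟩ {u = u} {v} ps r le) (_∷ʳ_⟨_⟩ {u = u'} {v'} qs r' le') =
  Copies-zip f ps qs ∷ʳ f r r'
    ⟨ ≤-trans (≤-reflexive (interchange u u' v v')) (+-mono-≤ le le') ⟩

-- The price of all copies of an argument: each one pays `B` for its size, `B` times its weight, and
-- its share of the environment.
Copies-weigh : ∀ {P Q R : ℕ → ℕ → Set} (B : ℕ) {n x y} →
  (∀ {a u v} → a < n → P a u → Q a v → R a (B + (B * u + v))) →
  Copies P n x → Copies Q n y → Copies R n (B * n + (B * x + y))
Copies-weigh B f [] [] = []
Copies-weigh B {suc n} f (_∷ʳ_⟨_⟩ {u = u} {v} ps r le) (_∷ʳ_⟨_⟩ {u = u'} {v'} qs r' le') =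
  Copies-weigh B (f ∘ m<n⇒m<1+n) ps qs ∷ʳ f ≤-refl r r'
    ⟨ ≤-trans (≤-reflexive (regroup B n u v u' v'))
              (+-monoʳ-≤ (B * suc n) (+-mono-≤ (*-monoʳ-≤ B le) le')) ⟩
  where
  regroup : ∀ B n u v u' v' → (B * n + (B * u + u')) + (B + (B * v + v'))
                              ≡ B * suc n + (B * (u + v) + (u' + v'))
  regroup = solve-∀

module _ {S : Signature} (E : EquationalProgram S) where
  open dℓPCF E
  open EquationalProgram E using (meaning)
  open Interpretation meaning using (graph; single-valued)

  -- Uniqueness of the values of index terms

  graph-functional : ∀ f {vs m m'} → graph f vs m → graph f vs m' → m ≡ m'
  graph-functional `0       {[]}         refl refl = refl
  graph-functional `1       {[]}         refl refl = refl
  graph-functional `+       {_ ∷ _ ∷ []} refl refl = refl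
  graph-functional `∸       {_ ∷ _ ∷ []} refl refl = refl
  graph-functional (user f) g g' = single-valued f g g'

  mutual
    -- Every true constraint brings its own evaluations of its two sides; uniqueness identifies them
    -- with the evaluations already at hand.
    ⇓-functional : ∀ {n} {ρ : Vec ℕ n} {I m m'} → ρ ⊢ I ⇓ m → ρ ⊢ I ⇓ m' → m ≡ m'
    ⇓-functional (var a) (var .a) = refl
    ⇓-functional (fn {f} ds g) (fn ds' g') =
      graph-functional f (subst (λ vs → graph f vs _) (⇓*-functional ds ds') g) g'
    ⇓-functional (∑ d ss) (∑ d' ss') with ⇓-functional d d'
    ... | refl = SumBelow-functional ss ss'
    ⇓-functional (△ d e fs) (△ d' e' fs') with ⇓-functional d d' | ⇓-functional e e'
    ... | refl | refl = Forest-functional fs fs'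

    ⇓*-functional : ∀ {n l} {ρ : Vec ℕ n} {Is : Vec (Index S n) l} {vs vs' : Vec ℕ l} →
      Pointwise (ρ ⊢_⇓_) Is vs → Pointwise (ρ ⊢_⇓_) Is vs' → vs ≡ vs'
    ⇓*-functional [] [] = refl
    ⇓*-functional (d ∷ ds) (d' ∷ ds') = cong₂ _∷_ (⇓-functional d d') (⇓*-functional ds ds')

    SumBelow-functional : ∀ {n} {ρ : Vec ℕ n} {J i m m'} →
      SumBelow ρ J i m → SumBelow ρ J i m' → m ≡ m'
    SumBelow-functional zero zero = refl
    SumBelow-functional (suc ss d) (suc ss' d') =
      cong₂ _+_ (SumBelow-functional ss ss') (⇓-functional d d')

    Forest-functional : ∀ {n} {ρ : Vec ℕ n} {K i j m m'} →
      Forest ρ K i j m → Forest ρ K i j m' → m ≡ m'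
    Forest-functional zero zero = refl
    Forest-functional (suc fs d gs) (suc fs' d' gs') with Forest-functional fs fs'
    ... | refl with ⇓-functional d d'
    ... | refl = cong (_ +_) (Forest-functional gs gs')

  -- Renaming and substitution in index terms

  SumBelow-map : ∀ {n n'} {ρ : Vec ℕ n} {ρ' : Vec ℕ n'} {J J'} →
    (∀ {a v} → a ∷ ρ ⊢ J ⇓ v → a ∷ ρ' ⊢ J' ⇓ v) →
    ∀ {i m} → SumBelow ρ J i m → SumBelow ρ' J' i m
  SumBelow-map f zero       = zero
  SumBelow-map f (suc ss d) = suc (SumBelow-map f ss) (f d)

  Forest-map : ∀ {n n'} {ρ : Vec ℕ n} {ρ' : Vec ℕ n'} {K K'} →
    (∀ {a v} → a ∷ ρ ⊢ K ⇓ v → a ∷ ρ' ⊢ K' ⇓ v) →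
    ∀ {i j m} → Forest ρ K i j m → Forest ρ' K' i j m
  Forest-map f zero          = zero
  Forest-map f (suc fs d gs) = suc (Forest-map f fs) (f d) (Forest-map f gs)

  Renames : ∀ {n k} → Vec ℕ k → (Fin n → Fin k) → Vec ℕ n → Set
  Renames ρ r ρ' = ∀ x → lookup ρ (r x) ≡ lookup ρ' x

  Renames-lift : ∀ {n k ρ ρ'} {r : Fin n → Fin k} → Renames ρ r ρ' →
    ∀ {a} → Renames (a ∷ ρ) (lift 1 r) (a ∷ ρ')
  Renames-lift e zero    = refl
  Renames-lift e (suc x) = e x

  mutual
    -- This comes before substitution because `lift-sub` weakens the substituted terms under the
    -- binders of `∑` and `△`.
    ⇓-ren : ∀ {n k ρ ρ'} {r : Fin n → Fin k} → Renames ρ r ρ' →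
      ∀ I {m} → (ρ ⊢ ren r I ⇓ m) ⇔ (ρ' ⊢ I ⇓ m)
    ⇓-ren {ρ = ρ} {ρ'} {r} e (var x) = mk⇔
      (λ { (var .(r x)) → subst (ρ' ⊢ var x ⇓_) (sym (e x)) (var x) })
      (λ { (var .x) → subst (ρ ⊢ var (r x) ⇓_) (e x) (var (r x)) })
    ⇓-ren e (fn f Is) = mk⇔
      (λ { (fn ds g) → fn (to (⇓*-ren e Is) ds) g })
      (λ { (fn ds g) → fn (from (⇓*-ren e Is) ds) g })
    ⇓-ren e (∑ I J) = mk⇔
      (λ { (∑ d ss) → ∑ (to (⇓-ren e I) d) (SumBelow-map (to (⇓-ren (Renames-lift e) J)) ss) })
      (λ { (∑ d ss) → ∑ (from (⇓-ren e I) d) (SumBelow-map (from (⇓-ren (Renames-lift e) J)) ss) })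
    ⇓-ren e (△ I J K) = mk⇔
      (λ { (△ d d' fs) → △ (to (⇓-ren e I) d) (to (⇓-ren e J) d')
                           (Forest-map (to (⇓-ren (Renames-lift e) K)) fs) })
      (λ { (△ d d' fs) → △ (from (⇓-ren e I) d) (from (⇓-ren e J) d')
                           (Forest-map (from (⇓-ren (Renames-lift e) K)) fs) })

    ⇓*-ren : ∀ {n k l ρ ρ'} {r : Fin n → Fin k} → Renames ρ r ρ' →
      ∀ (Is : Vec _ l) {vs : Vec ℕ l} → Pointwise (ρ ⊢_⇓_) (ren* r Is) vs ⇔ Pointwise (ρ' ⊢_⇓_) Is vs
    ⇓*-ren e [] = mk⇔ (λ { [] → [] }) (λ { [] → [] })
    ⇓*-ren e (I ∷ Is) = mk⇔
      (λ { (d ∷ ds) → to (⇓-ren e I) d ∷ to (⇓*-ren e Is) ds })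
      (λ { (d ∷ ds) → from (⇓-ren e I) d ∷ from (⇓*-ren e Is) ds })

  ⇓-wk : ∀ {n} {ρ : Vec ℕ n} {a I m} → ρ ⊢ I ⇓ m → a ∷ ρ ⊢ wk I ⇓ m
  ⇓-wk {I = I} = from (⇓-ren (λ _ → refl) I)

  ⇓-ren-lift² : ∀ {n} {ρ : Vec ℕ n} {a b c} J {m} →
    (a ∷ b ∷ c ∷ ρ ⊢ ren (lift 1 (λ x → suc (suc x))) J ⇓ m) ⇔ (a ∷ ρ ⊢ J ⇓ m)
  ⇓-ren-lift² = ⇓-ren (Renames-lift {r = λ x → suc (suc x)} λ _ → refl)

  Evaluates : ∀ {n k} → Vec ℕ k → Sub S n k → Vec ℕ n → Set
  Evaluates ρ θ ρ' = ∀ x → ρ ⊢ θ x ⇓ lookup ρ' x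

  Evaluates-lift : ∀ {n k ρ ρ'} {θ : Sub S n k} → Evaluates ρ θ ρ' →
    ∀ {a} → Evaluates (a ∷ ρ) (lift-sub θ) (a ∷ ρ')
  Evaluates-lift e zero    = var zero
  Evaluates-lift e (suc x) = ⇓-wk (e x)

  Evaluates-𝟎 : ∀ {n} {ρ : Vec ℕ n} → Evaluates ρ (𝟎 ▹ var) (0 ∷ ρ)
  Evaluates-𝟎 zero    = fn [] refl
  Evaluates-𝟎 (suc x) = var x

  mutual
    -- Both directions hold because `Evaluates` demands a value for every substituted term, so that
    -- neither definedness nor the value can change. The variable case from left to right is
    -- uniqueness of values.
    ⇓-sub : ∀ {n k ρ ρ'} {θ : Sub S n k} → Evaluates ρ θ ρ' →
      ∀ I {m} → (ρ ⊢ sub θ I ⇓ m) ⇔ (ρ' ⊢ I ⇓ m)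
    ⇓-sub {ρ' = ρ'} e (var x) = mk⇔
      (λ d → subst (ρ' ⊢ var x ⇓_) (⇓-functional (e x) d) (var x))
      (λ { (var .x) → e x })
    ⇓-sub e (fn f Is) = mk⇔
      (λ { (fn ds g) → fn (to (⇓*-sub e Is) ds) g })
      (λ { (fn ds g) → fn (from (⇓*-sub e Is) ds) g })
    ⇓-sub e (∑ I J) = mk⇔
      (λ { (∑ d ss) → ∑ (to (⇓-sub e I) d) (SumBelow-map (to (⇓-sub (Evaluates-lift e) J)) ss) })
      (λ { (∑ d ss) → ∑ (from (⇓-sub e I) d) (SumBelow-map (from (⇓-sub (Evaluates-lift e) J)) ss) })
    ⇓-sub e (△ I J K) = mk⇔
      (λ { (△ d d' fs) → △ (to (⇓-sub e I) d) (to (⇓-sub e J) d')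
                           (Forest-map (to (⇓-sub (Evaluates-lift e) K)) fs) })
      (λ { (△ d d' fs) → △ (from (⇓-sub e I) d) (from (⇓-sub e J) d')
                           (Forest-map (from (⇓-sub (Evaluates-lift e) K)) fs) })

    ⇓*-sub : ∀ {n k l ρ ρ'} {θ : Sub S n k} → Evaluates ρ θ ρ' →
      ∀ (Is : Vec _ l) {vs : Vec ℕ l} → Pointwise (ρ ⊢_⇓_) (sub* θ Is) vs ⇔ Pointwise (ρ' ⊢_⇓_) Is vs
    ⇓*-sub e [] = mk⇔ (λ { [] → [] }) (λ { [] → [] })
    ⇓*-sub e (I ∷ Is) = mk⇔
      (λ { (d ∷ ds) → to (⇓-sub e I) d ∷ to (⇓*-sub e Is) ds })
      (λ { (d ∷ ds) → from (⇓-sub e I) d ∷ from (⇓*-sub e Is) ds })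

  -- Numerals and true constraints

  numeral⇓ : ∀ {n} {ρ : Vec ℕ n} m → ρ ⊢ numeral m ⇓ m
  numeral⇓ zero          = fn [] refl
  numeral⇓ (suc zero)    = fn [] refl
  numeral⇓ (suc (suc m)) = fn (numeral⇓ (suc m) ∷ fn [] refl ∷ []) (sym (+-comm (suc m) 1))

  True-wk : ∀ {n} {ρ : Vec ℕ n} {a Φ} → All (True ρ) Φ → All (True (a ∷ ρ)) (wkᶜˢ Φ)
  True-wk []                                       = []
  True-wk {Φ = (I ≤ᶜ J) ∷ _} ((i , j , d , e , le) ∷ ts) = (i , j , ⇓-wk d , ⇓-wk e , le) ∷ True-wk ts

  True-< : ∀ {n} {ρ : Vec ℕ n} {I J i j} → ρ ⊢ I ⇓ i → ρ ⊢ J ⇓ j → i < j → True ρ (I <ᶜ J)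
  True-< {i = i} {j} d e i<j =
    i + 1 , j , fn (d ∷ fn [] refl ∷ []) refl , e , subst (_≤ j) (+-comm 1 i) i<j

  True-below : ∀ {n} {ρ : Vec ℕ n} {Φ I i a} → All (True ρ) Φ → ρ ⊢ I ⇓ i → a < i →
    All (True (a ∷ ρ)) ((var zero <ᶜ wk I) ∷ wkᶜˢ Φ)
  True-below ts d a<i = True-< (var zero) (⇓-wk d) a<i ∷ True-wk ts

  -- Realisability interpretation of types

  Within : ∀ {n} → Vec ℕ n → Index S n → Index S n → ℕ → Set
  Within ρ I J m = ∃[ i ] ∃[ j ] (ρ ⊢ I ⇓ i) × (ρ ⊢ J ⇓ j) × i ≤ m × m ≤ j

  mutual
    -- The relation inside `Copies` is `Realises`, unfolded so that the recursion is visibly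
    -- structural on the type. A numeral may carry any environment `η`. If a bound is undefined,
    -- nothing lies `Within` the interval and every stack accepts it.
    Accepts : ∀ {n} → Vec ℕ n → Basic S n → Stack → ℕ → Set
    Accepts ρ Nat[ I , J ] ξ b = ∀ m k (η : Env k) → Within ρ I J m → Safe ⟪ num m , η , ξ ⟫ b
    Accepts ρ (A ⊸ σ) ξ b = ∃[ c ] ∃[ ξ' ] ∃[ w ] ∃[ v ]
      ξ ≡ arg c ∷ ξ' × Supplies ρ A c w × Accepts ρ σ ξ' v × w + v ≡ b

    Supplies : ∀ {n} → Vec ℕ n → Modal S n → Closure → ℕ → Set
    Supplies ρ ([< I ]· σ) c w = ∃[ i ] (ρ ⊢ I ⇓ i) ×
      Copies (λ a u → ∀ ξ {v} → Accepts (a ∷ ρ) σ ξ v → Safe (enter c ξ) (u + v)) i w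

  Realises : ∀ {n} → Vec ℕ n → Basic S n → Closure → ℕ → Set
  Realises ρ σ c w = ∀ ξ {v} → Accepts ρ σ ξ v → Safe (enter c ξ) (w + v)

  data Suppliesᶜ {n} (ρ : Vec ℕ n) : ∀ {k} → Context S n k → Env k → ℕ → Set where
    []  : ∀ {w} → Suppliesᶜ ρ [] [] w
    _∷_ : ∀ {k} {A : Modal S n} {Γ : Context S n k} {c η w v} →
      Supplies ρ A c w → Suppliesᶜ ρ Γ η v → Suppliesᶜ ρ (A ∷ Γ) (c ∷ η) (w + v)

  -- Invariance under substitution and subtyping

  mutual
    Accepts-sub : ∀ {n k} {ρ : Vec ℕ k} {ρ' : Vec ℕ n} {θ} → Evaluates ρ θ ρ' →
      ∀ σ {ξ b} → Accepts ρ (subᵇ θ σ) ξ b ⇔ Accepts ρ' σ ξ b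
    Accepts-sub e Nat[ I , J ] = mk⇔
      (λ { acc m k η (i , j , d , d' , le) →
           acc m k η (i , j , from (⇓-sub e I) d , from (⇓-sub e J) d' , le) })
      (λ { acc m k η (i , j , d , d' , le) →
           acc m k η (i , j , to (⇓-sub e I) d , to (⇓-sub e J) d' , le) })
    Accepts-sub e (A ⊸ σ) = mk⇔
      (λ { (c , ξ , w , v , eq , sup , acc , eq') →
           c , ξ , w , v , eq , to (Supplies-sub e A) sup , to (Accepts-sub e σ) acc , eq' })
      (λ { (c , ξ , w , v , eq , sup , acc , eq') →
           c , ξ , w , v , eq , from (Supplies-sub e A) sup , from (Accepts-sub e σ) acc , eq' })

    Supplies-sub : ∀ {n k} {ρ : Vec ℕ k} {ρ' : Vec ℕ n} {θ} → Evaluates ρ θ ρ' →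
      ∀ A {c w} → Supplies ρ (subᵐ θ A) c w ⇔ Supplies ρ' A c w
    Supplies-sub e ([< I ]· σ) = mk⇔
      (λ { (i , d , cs) → i , to (⇓-sub e I) d ,
           Copies-map (λ _ r ξ acc → r ξ (from (Accepts-sub (Evaluates-lift e) σ) acc)) cs })
      (λ { (i , d , cs) → i , from (⇓-sub e I) d ,
           Copies-map (λ _ r ξ acc → r ξ (to (Accepts-sub (Evaluates-lift e) σ) acc)) cs })

  mutual
    -- Stacks consume values, so acceptance runs against subtyping: a numeral in the smaller
    -- interval lies in the larger one. The arguments stored on a stack are supplies, which run
    -- along with subtyping, and the two alternate at each arrow.
    Accepts-⊑ : ∀ {n} {ρ : Vec ℕ n} {Φ σ τ} → Φ ⊢ σ ⊑ᵇ τ → All (True ρ) Φ →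
      ∀ {ξ b} → Accepts ρ τ ξ b → Accepts ρ σ ξ b
    Accepts-⊑ {ρ = ρ} (nat K≤I J≤H) ts acc m k η (_ , _ , d , d' , i≤m , m≤j)
      with K≤I ρ ts | J≤H ρ ts
    ... | _ , _ , dK , dI , le | _ , _ , dJ , dH , le'
      with ⇓-functional d dI | ⇓-functional d' dJ
    ... | refl | refl = acc m k η (_ , _ , dK , dH , ≤-trans le i≤m , ≤-trans m≤j le')
    Accepts-⊑ (arr B⊑A σ⊑τ) ts (c , ξ , w , v , eq , sup , acc , eq') =
      c , ξ , w , v , eq , Supplies-⊑ B⊑A ts sup , Accepts-⊑ σ⊑τ ts acc , eq'

    Supplies-⊑ : ∀ {n} {ρ : Vec ℕ n} {Φ A B} → Φ ⊢ A ⊑ᵐ B → All (True ρ) Φ →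
      ∀ {c w} → Supplies ρ A c w → Supplies ρ B c w
    Supplies-⊑ {ρ = ρ} (mod σ⊑τ J≤I) ts (i , d , cs) with J≤I ρ ts
    ... | j , _ , dJ , dI , le with ⇓-functional d dI
    ... | refl = j , dJ , Copies-take le
      (Copies-map (λ a<i r ξ acc → r ξ (Accepts-⊑ σ⊑τ (True-below ts d a<i) acc)) cs)

  -- Supplies for contexts, unions and sums

  Supplies-mono : ∀ {n} {ρ : Vec ℕ n} A {c w w'} → w ≤ w' → Supplies ρ A c w → Supplies ρ A c w'
  Supplies-mono ([< I ]· σ) le (i , d , cs) = i , d , Copies-mono le cs

  Suppliesᶜ-lookup : ∀ {n k} {ρ : Vec ℕ n} {Γ : Context S n k} {η w} →
    Suppliesᶜ ρ Γ η w → ∀ x → Supplies ρ (lookup Γ x) (lookup η x) w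
  Suppliesᶜ-lookup (_∷_ {A = A} {w = w} {v} sup _) zero = Supplies-mono A (m≤m+n w v) sup
  Suppliesᶜ-lookup (_∷_ {Γ = Γ} {w = w} {v} _ sups) (suc x) =
    Supplies-mono (lookup Γ x) (m≤n+m v w) (Suppliesᶜ-lookup sups x)

  Suppliesᶜ-⊑ : ∀ {n k} {ρ : Vec ℕ n} {Φ} {Γ Δ : Context S n k} → Φ ⊢ Γ ⊑ᶜ Δ → All (True ρ) Φ →
    ∀ {η w} → Suppliesᶜ ρ Γ η w → Suppliesᶜ ρ Δ η w
  Suppliesᶜ-⊑ {Δ = []}    sub ts []           = []
  Suppliesᶜ-⊑ {Δ = _ ∷ _} sub ts (sup ∷ sups) =
    Supplies-⊑ (sub zero) ts sup ∷ Suppliesᶜ-⊑ (sub ∘ suc) ts sups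

  -- The joint supply is cut after its first `i` copies; copy `a` of the second part is copy `i + a`
  -- of the whole, which is the substitution made in `union`.
  Supplies-⊎ : ∀ {n} {ρ : Vec ℕ n} {A B C} → A ⊎ B ≈ C → ∀ {c w} → Supplies ρ C c w →
    ∃[ u ] ∃[ v ] Supplies ρ A c u × Supplies ρ B c v × u + v ≤ w
  Supplies-⊎ {ρ = ρ} (union {μ = μ}) (_ , fn {vs = i ∷ j ∷ []} (dI ∷ dJ ∷ []) refl , cs)
    with Copies-split i j cs
  ... | u , v , cs₁ , cs₂ , le =
    u , v , (i , dI , cs₁) ,
    (j , dJ , Copies-map (λ _ r ξ acc → r ξ (to (Accepts-sub shift μ) acc)) cs₂) , le
    where
    shift : ∀ {a} → Evaluates (a ∷ ρ) _ (i + a ∷ ρ)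
    shift zero    = fn (⇓-wk dI ∷ var zero ∷ []) refl
    shift (suc x) = var (suc x)

  Suppliesᶜ-⊎ : ∀ {n k} {ρ : Vec ℕ n} {Γ Δ Θ : Context S n k} → Γ ⊎ᶜ Δ ≈ Θ →
    ∀ {η w} → Suppliesᶜ ρ Θ η w →
    ∃[ u ] ∃[ v ] Suppliesᶜ ρ Γ η u × Suppliesᶜ ρ Δ η v × u + v ≤ w
  Suppliesᶜ-⊎ {Γ = []} {[]} un [] = 0 , 0 , [] , [] , z≤n
  Suppliesᶜ-⊎ {Γ = _ ∷ _} {_ ∷ _} un (sup ∷ sups)
    with Supplies-⊎ (un zero) sup | Suppliesᶜ-⊎ (un ∘ suc) sups
  ... | u , v , s₁ , s₂ , le | u' , v' , ss₁ , ss₂ , le' =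
    u + u' , v + v' , s₁ ∷ ss₁ , s₂ ∷ ss₂ ,
    ≤-trans (≤-reflexive (interchange u u' v v')) (+-mono-≤ le le')

  -- The supply is cut into consecutive blocks, one for each value of the summation variable, taking
  -- off the last block first.
  Supplies-∑ : ∀ {n} {ρ : Vec ℕ n} {I i A B} → Sum I A B → ρ ⊢ I ⇓ i → ∀ {c w} →
    Supplies ρ B c w → Copies (λ a → Supplies (a ∷ ρ) A c) i w
  Supplies-∑ {ρ = ρ} {A = A} (sum {J} {σ}) dI {c} (_ , ∑ dI' ss , cs)
    with ⇓-functional dI dI'
  ... | refl = distribute ss cs
    where
    -- Block `i` begins at the partial sum `m` of the values of `J` below `i`, so its copy `a` is
    -- copy `m + a` of the whole.
    shift : ∀ {i m a} → SumBelow ρ J i m → Evaluates (a ∷ i ∷ ρ)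
      ((∑ (var (suc zero)) (ren (lift 1 (λ x → suc (suc x))) J) ⊕ var zero) ▹ ↑²) (m + a ∷ ρ)
    shift ss zero = fn (∑ (var (suc zero)) (SumBelow-map (from (⇓-ren-lift² J)) ss) ∷ var zero ∷ []) refl
    shift ss (suc x) = var (suc (suc x))

    distribute : ∀ {i m w} → SumBelow ρ J i m → Copies (λ a → Realises (a ∷ ρ) σ c) m w →
      Copies (λ a → Supplies (a ∷ ρ) A c) i w
    distribute zero cs = []
    distribute (suc {m = m} {v} ss d) cs with Copies-split m v cs
    ... | _ , _ , cs₁ , cs₂ , le = distribute ss cs₁ ∷ʳ
      (v , d , Copies-map (λ _ r ξ acc → r ξ (to (Accepts-sub (shift ss) σ) acc)) cs₂) ⟨ le ⟩

  Suppliesᶜ-∑ : ∀ {n k} {ρ : Vec ℕ n} {I i} {Γ : Context S (suc n) k} {Θ} → Sumᶜ I Γ Θ →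
    ρ ⊢ I ⇓ i → ∀ {η w} → Suppliesᶜ ρ Θ η w → Copies (λ a → Suppliesᶜ (a ∷ ρ) Γ η) i w
  Suppliesᶜ-∑ {i = i} {[]} su d [] = none i
    where
    none : ∀ {n} {ρ : Vec ℕ n} {w} i → Copies (λ a → Suppliesᶜ (a ∷ ρ) [] []) i w
    none zero    = []
    none (suc i) = none {w = 0} i ∷ʳ [] {w = 0} ⟨ z≤n ⟩
  Suppliesᶜ-∑ {Γ = _ ∷ _} su d (sup ∷ sups) =
    Copies-zip _∷_ (Supplies-∑ (su zero) d sup) (Suppliesᶜ-∑ (su ∘ suc) d sups)

  -- Weights and forests

  SumBelow⇒Copies : ∀ {n} {ρ : Vec ℕ n} {J i m} → SumBelow ρ J i m →
    Copies (λ a v → a ∷ ρ ⊢ J ⇓ v) i m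
  SumBelow⇒Copies zero       = []
  SumBelow⇒Copies (suc ss d) = SumBelow⇒Copies ss ∷ʳ d ⟨ ≤-refl ⟩

  -- A true constraint has defined sides, and every rule either constrains its weight or takes it
  -- over from a premise.
  weight-defined : ∀ {n k} {Φ} {Γ : Context S n k} {I t σ} → Φ ⨾ Γ ⊢[ I ] t ∶ σ →
    ∀ {ρ} → All (True ρ) Φ → ∃[ i ] ρ ⊢ I ⇓ i
  weight-defined (T-V _ 0≤J _ _ _) {ρ} ts with 0≤J ρ ts
  ... | _ , j , _ , d , _ = j , d
  weight-defined (T-L D) ts = weight-defined D ts
  weight-defined (T-A _ _ _ _ _ H≥) {ρ} ts with H≥ ρ ts
  ... | _ , h , _ , d , _ = h , d
  weight-defined (T-N K≥0 _ _ _) {ρ} ts with K≥0 ρ ts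
  ... | _ , k , _ , d , _ = k , d
  weight-defined (T-S D _) ts = weight-defined D ts
  weight-defined (T-P D _) ts = weight-defined D ts
  weight-defined (T-F _ _ _ _ _ M≥) {ρ} ts with M≥ ρ ts
  ... | _ , m , _ , d , _ = m , d
  weight-defined (T-R _ _ _ _ _ _ _ N≥) {ρ} ts with N≥ ρ ts
  ... | _ , n , _ , d , _ = n , d

  -- The trees are counted from 0, so f nodes precede the root of tree a, which is node i + f.
  Root : ∀ {n} → Vec ℕ n → Index S (suc n) → (ℕ → ℕ → Set) → ℕ → ℕ → ℕ → Set
  Root ρ I R i a u = ∃[ f ] Forest ρ I i a f × R (i + f) u

  module _ {n} {ρ : Vec ℕ n} {I : Index S (suc n)} (B l : ℕ) {P Q R : ℕ → ℕ → Set} where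

    -- Induction on the unfolding of the forest. The last tree is the root `i + f` followed by the
    -- forest of its children, so the shares split into three consecutive blocks: the earlier trees,
    -- the root, its descendants. A node is treated after its children, and each node pays `B` once.
    forest-roots :
      (∀ {b k x y z} → b < l → b ∷ ρ ⊢ I ⇓ k → P b x → Q b y → Copies (Root ρ I R (suc b)) k z →
         R b (B + (B * x + y) + z)) →
      ∀ {i j f} → Forest ρ I i j f → i + f ≤ l →
      ∀ {x y} → Copies (P ∘ (i +_)) f x → Copies (Q ∘ (i +_)) f y →
      Copies (Root ρ I R i) j (B * f + (B * x + y))
    forest-roots node zero le ps qs = []
    forest-roots node {i} (suc {f = f} {k} {g} fs d gs) le {x} {y} ps qs
      with Copies-split (f + 1) g ps | Copies-split (f + 1) g qs
    ... | x₁₂ , x₃ , ps₁₂ , ps₃ , lex | y₁₂ , y₃ , qs₁₂ , qs₃ , ley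
      with Copies-split f 1 ps₁₂ | Copies-split f 1 qs₁₂
    ... | x₁ , x₂' , ps₁ , ps₂ , lex' | y₁ , y₂' , qs₁ , qs₂ , ley'
      with Copies-single ps₂ | Copies-single qs₂
    ... | x₂ , p₂ , lex'' | y₂ , q₂ , ley'' =
      forest-roots node fs (m+n≤o⇒m≤o (i + f) f<) ps₁ qs₁
        ∷ʳ f , fs , node (m+n≤o⇒m≤o (suc (i + f)) {g} (subst (_≤ l) (flat i f g) le)) d
                         (subst (λ b → P (i + b) x₂) (+-identityʳ f) p₂)
                         (subst (λ b → Q (i + b) y₂) (+-identityʳ f) q₂)
                         -- In pre-order the first child comes right after its parent, at number
                         -- `suc (i + f)`.
                         (subst (λ b → Copies (Root ρ I R b) k (B * g + (B * x₃ + y₃))) (start i f)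
                           (forest-roots node gs (subst (_≤ l) (shift i f g) le)
                             (move P ps₃) (move Q qs₃)))
        ⟨ bound ⟩
      where
      flat : ∀ i f g → i + (f + 1 + g) ≡ suc (i + f) + g
      flat = solve-∀
      shift : ∀ i f b → i + (f + 1 + b) ≡ i + 1 + f + b
      shift = solve-∀
      start : ∀ i f → i + 1 + f ≡ suc (i + f)
      start = solve-∀
      f< : i + f + (1 + g) ≤ l
      f< = subst (_≤ l) (trans (flat i f g) (sym (+-suc (i + f) g))) le
      move : ∀ (T : ℕ → ℕ → Set) {w} → Copies (T ∘ (i +_) ∘ (f + 1 +_)) g w →
        Copies (T ∘ (i + 1 + f +_)) g w
      move T = Copies-map (λ {a} {u} _ → subst (λ b → T b u) (shift i f a))
      total : ∀ {u₁ u₂ u₂' u₃ u₁₂ u} → u₁₂ + u₃ ≤ u → u₁ + u₂' ≤ u₁₂ → u₂ ≤ u₂' →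
        u₁ + u₂ + u₃ ≤ u
      total {u₁} {u₃ = u₃} le₁ le₂ le₃ =
        ≤-trans (+-monoˡ-≤ u₃ (≤-trans (+-monoʳ-≤ u₁ le₃) le₂)) le₁
      regroup : ∀ B f g x₁ x₂ x₃ y₁ y₂ y₃ →
        B * f + (B * x₁ + y₁) + (B + (B * x₂ + y₂) + (B * g + (B * x₃ + y₃)))
        ≡ B * (f + 1 + g) + (B * (x₁ + x₂ + x₃) + (y₁ + y₂ + y₃))
      regroup = solve-∀
      bound : B * f + (B * x₁ + y₁) + (B + (B * x₂ + y₂) + (B * g + (B * x₃ + y₃)))
              ≤ B * (f + 1 + g) + (B * x + y)
      bound = ≤-trans (≤-reflexive (regroup B f g x₁ x₂ x₃ y₁ y₂ y₃))
        (+-monoʳ-≤ (B * (f + 1 + g))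
          (+-mono-≤ (*-monoʳ-≤ B (total lex lex' lex'')) (total ley ley' ley'')))

  -- Soundness of the typing rules

  module _ (B : ℕ) where

    -- Induction on the typing derivation. Subterms inherit the bound by `B`, so one constant prices
    -- every copy of every argument.
    realise : ∀ {n k} {Φ : Constraints S n} {Γ : Context S n k} {I t σ} → Φ ⨾ Γ ⊢[ I ] t ∶ σ →
      ∣ t ∣ ≤ B → ∀ {ρ} → All (True ρ) Φ → ∀ {i} → ρ ⊢ I ⇓ i →
      ∀ {η w} → Suppliesᶜ ρ Γ η w → Realises ρ σ ⟨ t , η ⟩ (∣ t ∣ + B * i + w)

    realise (T-V {x = x} {σ = σ} x∈Γ _ 1≤I σ⊑τ _) _ {ρ} ts {i} dI {w = w} sups ξ {v} acc
      with subst (λ A → Supplies ρ A _ w) x∈Γ (Suppliesᶜ-lookup sups x) | 1≤I ρ ts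
    ... | j , dJ , cs | .1 , _ , fn [] refl , dJ' , 1≤j with ⇓-functional dJ dJ'
    ... | refl with Copies-single (Copies-take 1≤j cs)
    -- The size 1 of the variable pays for the lookup. The occurrence consumes copy 0 of the
    -- closure, whose cost is part of `w`.
    ... | u , r , u≤w = Safe-mono (s≤s (+-monoˡ-≤ v (≤-trans u≤w (m≤n+m w (B * i)))))
      (Safe-step λ { var → r ξ (to (Accepts-sub Evaluates-𝟎 σ) (Accepts-⊑ σ⊑τ ts acc)) })

    realise (T-L {t = t} D) t≤B ts {i} dI {w = w} sups _ (c , ξ , u , v , refl , sup , acc , refl) =
      Safe-mono (≤-reflexive (eq ∣ t ∣ (B * i) w u v))
        (Safe-step λ { lam → realise D (m+n≤o⇒m≤o ∣ t ∣ t≤B) ts dI (sup ∷ sups) ξ acc })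
      where
      eq : ∀ t x w u v → suc (t + x + (u + w) + v) ≡ t + 1 + x + w + (u + v)
      eq = solve-∀

    realise (T-A {Δ' = Δ'} {Θ} {t = t} {u} {σ} D D' sm un sub H≥) t≤B {ρ} ts dH
        {η} {w} sups ξ {v} acc
      with H≥ ρ ts
    ... | _ , h , fn (fn {vs = j ∷ i ∷ []} (dJ ∷ dI ∷ []) refl ∷ ∑ {m = x} dI' ss ∷ []) refl , dH' , le
      with ⇓-functional dH dH' | ⇓-functional dI dI'
    ... | refl | refl with Suppliesᶜ-⊎ un (Suppliesᶜ-⊑ {Δ = Θ} sub ts sups)
    ... | w₁ , w₂ , sups₁ , sups₂ , le' =
      Safe-mono bound
        (Safe-step λ { app →
          realise D (m+n≤o⇒m≤o ∣ t ∣ (m+n≤o⇒m≤o (∣ t ∣ + ∣ u ∣) t≤B)) ts dJ sups₁ _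
            -- The argument costs `B * i` for the sizes of its `i` copies, `B * x` for their weights
            -- and `w₂` for their environments.
            (⟨ u , η ⟩ , ξ , B * i + (B * x + w₂) , v , refl , (i , dI , args) , acc , refl) })
      where
      u≤B : ∣ u ∣ ≤ B
      u≤B = m+n≤o⇒n≤o ∣ t ∣ (m+n≤o⇒m≤o (∣ t ∣ + ∣ u ∣) t≤B)
      args : Copies (λ a → Realises (a ∷ ρ) σ ⟨ u , η ⟩) i (B * i + (B * x + w₂))
      args = Copies-weigh B
        (λ {_} {y} {z} a<i dK sup ξ {v} acc → Safe-mono
          (+-monoˡ-≤ v (≤-trans (≤-reflexive (+-assoc ∣ u ∣ (B * y) z)) (+-monoˡ-≤ _ u≤B)))
          (realise D' u≤B (True-below ts dI a<i) dK sup ξ acc))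
        (SumBelow⇒Copies ss) (Suppliesᶜ-∑ {Θ = Δ'} sm dI sups₂)
      eq : ∀ B t j i x w₁ w₂ v → suc (t + B * j + w₁ + (B * i + (B * x + w₂) + v))
                                 ≡ t + 1 + B * (j + i + x) + (w₁ + w₂) + v
      eq = solve-∀
      bound : suc (∣ t ∣ + B * j + w₁ + (B * i + (B * x + w₂) + v))
              ≤ ∣ t ∣ + ∣ u ∣ + 1 + B * h + w + v
      bound = ≤-trans (≤-reflexive (eq B ∣ t ∣ j i x w₁ w₂ v))
        (+-monoˡ-≤ v (+-mono-≤ (+-mono-≤ (+-monoˡ-≤ 1 (m≤m+n ∣ t ∣ ∣ u ∣)) (*-monoʳ-≤ B le)) le'))

    realise (T-N {m = m} _ I≤m m≤J _) _ {ρ} ts {i} dK {w = w} sups ξ {v} acc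
      with I≤m ρ ts | m≤J ρ ts
    ... | lo , _ , dI , dm , le | _ , hi , dm' , dJ , le'
      with ⇓-functional (numeral⇓ m) dm | ⇓-functional (numeral⇓ m) dm'
    ... | refl | refl =
      Safe-mono (m≤n+m v (1 + B * i + w)) (acc m _ _ (lo , hi , dI , dJ , le , le'))

    realise (T-S {I = I} {J} {t = t} D sub) t≤B {ρ} ts {i} dM {w = w} sups ξ {v} acc =
      Safe-mono (≤-reflexive (eq ∣ t ∣ (B * i) w v))
        (Safe-step λ { s → realise D (m+n≤o⇒m≤o ∣ t ∣ t≤B) ts dM sups _ frame })
      where
      -- Of the two units that `s` adds to the size, one pays for pushing the frame and the other,
      -- inside `suc v`, for popping it.
      frame : Accepts ρ Nat[ I , J ] (s ∷ ξ) (suc v)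
      frame m _ η (lo , hi , dI , dJ , lo≤m , m≤hi) = Safe-step λ { num-s →
        Accepts-⊑ sub ts {ξ} acc (suc m) _ η
          (lo + 1 , hi + 1 , fn (dI ∷ fn [] refl ∷ []) refl , fn (dJ ∷ fn [] refl ∷ []) refl ,
           subst (lo + 1 ≤_) (+-comm m 1) (+-monoˡ-≤ 1 lo≤m) ,
           subst (_≤ hi + 1) (+-comm m 1) (+-monoˡ-≤ 1 m≤hi)) }
      eq : ∀ t x w v → suc (t + x + w + suc v) ≡ t + 2 + x + w + v
      eq = solve-∀

    realise (T-P {I = I} {J} {t = t} D sub) t≤B {ρ} ts {i} dM {w = w} sups ξ {v} acc =
      Safe-mono (≤-reflexive (eq ∣ t ∣ (B * i) w v))
        (Safe-step λ { p → realise D (m+n≤o⇒m≤o ∣ t ∣ t≤B) ts dM sups _ frame })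
      where
      frame : Accepts ρ Nat[ I , J ] (p ∷ ξ) (suc v)
      frame m _ η (lo , hi , dI , dJ , lo≤m , m≤hi) = Safe-step λ { num-p →
        Accepts-⊑ sub ts {ξ} acc (m ∸ 1) _ η
          (lo ∸ 1 , hi ∸ 1 , fn (dI ∷ fn [] refl ∷ []) refl , fn (dJ ∷ fn [] refl ∷ []) refl ,
           ∸-monoˡ-≤ 1 lo≤m , ∸-monoˡ-≤ 1 m≤hi) }
      eq : ∀ t x w v → suc (t + x + w + suc v) ≡ t + 2 + x + w + v
      eq = solve-∀

    realise (T-F {Θ = Θ} {I = I} {J} {t = t} {u} {u'} D D₀ D₊ un sub M≥) t≤B {ρ} ts dM
        {η} {w} sups ξ {v} acc
      with M≥ ρ ts
    ... | _ , m , fn {vs = k ∷ h ∷ []} (dK ∷ dH ∷ []) refl , dM' , le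
      with ⇓-functional dM dM' | Suppliesᶜ-⊎ un (Suppliesᶜ-⊑ {Δ = Θ} sub ts sups)
    ... | refl | w₁ , w₂ , sups₁ , sups₂ , le' =
      Safe-mono bound (Safe-step λ { ifz →
        realise D (m+n≤o⇒m≤o ∣ t ∣ (m+n≤o⇒m≤o (∣ t ∣ + ∣ u ∣) tu≤B)) ts dK sups₁ _ frame })
      where
      tu≤B : ∣ t ∣ + ∣ u ∣ + ∣ u' ∣ ≤ B
      tu≤B = m+n≤o⇒m≤o (∣ t ∣ + ∣ u ∣ + ∣ u' ∣) t≤B
      rest : ℕ
      rest = B * h + w₂ + v
      branch-cost : ∀ z {y} → suc z ≤ y → suc (z + B * h + w₂ + v) ≤ y + rest
      branch-cost z {y} z<y = ≤-trans (≤-reflexive (assoc z (B * h) w₂ v)) (+-monoˡ-≤ rest z<y)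
        where
        assoc : ∀ z x w v → suc (z + x + w + v) ≡ suc z + (x + w + v)
        assoc = solve-∀
      frame : Accepts ρ Nat[ I , J ] (branch u u' η ∷ ξ) (∣ u ∣ + ∣ u' ∣ + rest)
      frame zero _ _ (lo , hi , dI , dJ , lo≤m , m≤hi) =
        Safe-mono
          (branch-cost ∣ u ∣
            (subst (_≤ ∣ u ∣ + ∣ u' ∣) (+-comm ∣ u ∣ 1) (+-monoʳ-≤ ∣ u ∣ 1≤∣ u' ∣)))
          (Safe-step λ { num-0 →
            realise D₀ (m+n≤o⇒n≤o ∣ t ∣ (m+n≤o⇒m≤o (∣ t ∣ + ∣ u ∣) tu≤B))
              -- The numeral 0 forces the lower bound to be at most 0, so the extra assumption of
              -- this branch is true. A derivation is interpreted only for the branch that is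
              -- entered.
              ((lo , 0 , dI , fn [] refl , lo≤m) ∷ ts) dH sups₂ ξ acc })
      frame (suc _) _ _ (lo , hi , dI , dJ , lo≤m , m≤hi) =
        Safe-mono (branch-cost ∣ u' ∣ (+-monoˡ-≤ ∣ u' ∣ 1≤∣ u ∣))
          (Safe-step λ { num-+ →
            realise D₊ (m+n≤o⇒n≤o (∣ t ∣ + ∣ u ∣) tu≤B)
              ((1 , hi , fn [] refl , dJ , ≤-trans (s≤s z≤n) m≤hi) ∷ ts) dH sups₂ ξ acc })
      eq : ∀ B t u u' k h w₁ w₂ v → suc (t + B * k + w₁ + (u + u' + (B * h + w₂ + v)))
                                    ≡ t + u + u' + 1 + B * (k + h) + (w₁ + w₂) + v
      eq = solve-∀
      bound : suc (∣ t ∣ + B * k + w₁ + (∣ u ∣ + ∣ u' ∣ + rest))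
              ≤ ∣ t ∣ + ∣ u ∣ + ∣ u' ∣ + 1 + B * m + w + v
      bound = ≤-trans (≤-reflexive (eq B (∣ t ∣) (∣ u ∣) (∣ u' ∣) k h w₁ w₂ v))
        (+-monoˡ-≤ v (+-mono-≤ (+-monoʳ-≤ (∣ t ∣ + ∣ u ∣ + ∣ u' ∣ + 1) (*-monoʳ-≤ B le)) le'))

    realise (T-R {Γ = Γ} {Θ} {I = I} {K} {L} {t = t} {τ = τ} D τ₀⊑μ τ⊑σ sm sub ≤L ≤M N≥) t≤B {ρ} ts
        dN {η} {w} sups ξ {v} acc
      with N≥ ρ ts | ≤L ρ ts | ≤M ρ ts
    ... | _ , n , fn (fn (dM ∷ fn [] refl ∷ []) refl ∷ ∑ {i = l} dL ss ∷ []) refl , dN' , leN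
        | _ , _ , △ (fn [] refl) (fn [] refl) (suc {g = g} zero d₀ fs) , dL' , leL
        | _ , _ , △ (fn [] refl) (fn [] refl) fs' , dM' , leM
      with ⇓-functional dN dN' | ⇓-functional dL dL' | ⇓-functional dM dM'
         | Forest-functional (suc zero d₀ fs) fs'
    ... | refl | refl | refl | refl
      -- The forest has a single tree: node 0, the first call, and `g` nodes below it. The surplus
      -- of shares, when `L` exceeds their number, is dropped.
      with Copies-split 1 g (Copies-take leL (SumBelow⇒Copies ss))
         | Copies-split 1 g (Copies-take leL (Suppliesᶜ-∑ sm dL (Suppliesᶜ-⊑ {Δ = Θ} sub ts sups)))
    ... | x₁ , x₂ , ps₁ , ps₂ , lex | y₁ , y₂ , qs₁ , qs₂ , ley
      with Copies-single ps₁ | Copies-single qs₁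
    ... | x₀ , dK₀ , lex' | y₀ , sup₀ , ley' =
      Safe-mono (+-monoˡ-≤ v bound)
        -- The root pays with the size of the fixpoint itself; only the other `g` nodes pay `B`, and
        -- `M ⊖ 𝟏` in the weight covers them.
        (node (≤-trans (s≤s z≤n) leL) d₀ dK₀ sup₀
          (forest-roots B l {R = λ b → Realises (b ∷ ρ) τ c} node≤B fs leL ps₂ qs₂)
          ξ (to (Accepts-sub Evaluates-𝟎 τ) (Accepts-⊑ τ₀⊑μ ts acc)))
      where
      c : Closure
      c = ⟨ fix t , η ⟩

      Children : ℕ → ℕ → ℕ → Set
      Children b = Copies (Root ρ I (λ b → Realises (b ∷ ρ) τ c) (suc b))

      -- The trees of the first `a` children of node `b` fill the `f` numbers after `b`, so child
      -- `a` is node `suc b + f`.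
      child : ∀ {a b f} → Forest ρ I (suc b) a f →
        Evaluates (a ∷ b ∷ ρ)
          ((△ (var (suc zero) ⊕ 𝟏) (var zero) (ren (lift 1 (λ x → suc (suc x))) I)
             ⊕ var (suc zero) ⊕ 𝟏) ▹ ↑²)
          (suc b + f ∷ ρ)
      child {a} {b} {f} fs zero =
        fn (fn (△ (fn (var (suc zero) ∷ fn [] refl ∷ []) refl) (var zero)
                 (Forest-map (from (⇓-ren-lift² I))
                   (subst (λ i → Forest ρ I i a f) (+-comm 1 b) fs))
               ∷ var (suc zero) ∷ []) refl ∷ fn [] refl ∷ []) (eq b f)
        where
        eq : ∀ b f → suc b + f ≡ f + b + 1
        eq = solve-∀
      child fs (suc x) = var (suc (suc x))

      -- One unit pays for the unrolling step, after which the `k` children of node `b` act as the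
      -- `k` copies of the recursive variable.
      node : ∀ {b k x y z} → b < l → b ∷ ρ ⊢ I ⇓ k → b ∷ ρ ⊢ K ⇓ x → Suppliesᶜ (b ∷ ρ) Γ η y →
        Children b k z → Realises (b ∷ ρ) τ c (∣ t ∣ + 1 + (B * x + y) + z)
      node {b} {k} {x} {y} {z} b<l dI dK sup cs ξ {v} acc =
        Safe-mono (≤-reflexive (eq ∣ t ∣ (B * x) y z v))
          (Safe-step λ { fix → realise D (m+n≤o⇒m≤o ∣ t ∣ t≤B) b-true dK
            ((k , dI , Copies-map (λ { a<k (f , fs , r) ξ acc →
               r ξ (to (Accepts-sub (child fs) τ)
                 (Accepts-⊑ τ⊑σ (True-< (var zero) (⇓-wk dI) a<k ∷ True-wk b-true) acc)) }) cs) ∷ sup)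
            ξ acc })
        where
        b-true : All (True (b ∷ ρ)) ((var zero <ᶜ wk L) ∷ wkᶜˢ _)
        b-true = True-below ts dL b<l
        eq : ∀ t x y z v → suc (t + x + (z + y) + v) ≡ t + 1 + (x + y) + z + v
        eq = solve-∀

      -- Below the root the size of the fixpoint is rounded up to `B`, the price of one unit of
      -- weight.
      node≤B : ∀ {b k x y z} → b < l → b ∷ ρ ⊢ I ⇓ k → b ∷ ρ ⊢ K ⇓ x → Suppliesᶜ (b ∷ ρ) Γ η y →
        Children b k z → Realises (b ∷ ρ) τ c (B + (B * x + y) + z)
      node≤B {x = x} {y} {z} b<l dI dK sup cs ξ {v} acc =
        Safe-mono (+-monoˡ-≤ v (+-monoˡ-≤ z (+-monoˡ-≤ (B * x + y) t≤B))) (node b<l dI dK sup cs ξ acc)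

      eq : ∀ B t x₀ y₀ g x₂ y₂ → t + (B * x₀ + y₀) + (B * g + (B * x₂ + y₂))
                                 ≡ t + B * (g + (x₀ + x₂)) + (y₀ + y₂)
      eq = solve-∀
      bound : ∣ t ∣ + 1 + (B * x₀ + y₀) + (B * g + (B * x₂ + y₂)) ≤ ∣ t ∣ + 1 + B * n + w
      bound = ≤-trans (≤-reflexive (eq B (∣ t ∣ + 1) x₀ y₀ g x₂ y₂))
        (+-mono-≤
          (+-monoʳ-≤ (∣ t ∣ + 1) (*-monoʳ-≤ B
            (≤-trans (+-mono-≤ (∸-monoˡ-≤ 1 leM) (≤-trans (+-monoˡ-≤ x₂ lex') lex)) leN)))
          (≤-trans (+-monoˡ-≤ y₂ ley') ley))

theorem4p6 : (S : Signature) (E : EquationalProgram S) → let open dℓPCF E in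
    (t : Term 0) (I J K : Index S 0) (n m : ℕ) →
    ([] ⨾ [] ⊢[ I ] t ∶ Nat[ J , K ]) →
    t ⇓[ n ] m →
    ∃[ i ] (([] ⊢ I ⇓ i) × n ≤ ∣ t ∣ * (i + 1))
theorem4p6 S E t I J K n m D (_ , _ , run) with weight-defined E D []
... | i , d = i , d , ≤-trans
  -- Here `B` is the size of the program itself. The empty stack accepts the type with budget 0,
  -- since a numeral has no transition on it.
  (realise E ∣ t ∣ D ≤-refl [] d {w = 0} [] [] {0} (λ { _ _ _ _ done → z≤n }) run)
  (≤-reflexive (eq ∣ t ∣ i))
  where
  eq : ∀ t i → t + t * i + 0 + 0 ≡ t * (i + 1)
  eq = solve-∀
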